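{- Suppose $|A|>1$. Then there exists a Hoare-McCarthy algebra $\mathbb{A}^{wm}$ (over the atom set $A$) such that for all closed terms $t,t'\in\mathcal{T}_{\Sigma^A_{ce}}$, $$\mathrm{CP}_{wm}\vdash t=t'\iff \mathbb{A}^{wm}\models t=t'.$$
   Context: Let $A$ be a non-empty, denumerable (finite or countably infinite) set of atoms. $\Sigma^A_{ce}$ is the one-sorted signature with sort $C$ (conditional expressions), constants $T$, $F$ and $a$ (one for each $a\in A$), and a ternary operation $x\triangleleft y\triangleright z$ ("if $y$ then $x$ else $z$"). $\mathcal{T}_{\Sigma^A_{ce}}$ is the set of closed (variable-free) terms over $\Sigma^A_{ce}$. $\mathrm{CP}$ is the set of the four equations (CP1) $x\triangleleft T\triangleright y=x$; (CP2) $x\triangleleft F\triangleright y=y$; (CP3) $T\triangleleft x\triangleright F=x$; (CP4) $x\triangleleft(y\triangleleft z\triangleright u)\triangleright v=(x\triangleleft y\triangleright v)\triangleleft z\triangleright(x\triangleleft u\triangleright v)$. $\mathrm{CP}_{wm}$ is $\mathrm{CP}$ together with, for all $a,b\in A$, the equations (CPcr1) $(x\triangleleft a\triangleright y)\triangleleft a\triangleright z=x\triangleleft a\triangleright z$; (CPcr2) $x\triangleleft a\triangleright(y\triangleleft a\triangleright z)=x\triangleleft a\triangleright z$; (CPwm1) $((x\triangleleft a\triangleright y)\triangleleft b\triangleright z)\triangleleft a\triangleright v=(x\triangleleft b\triangleright z)\triangleleft a\triangleright v$; (CPwm2) $x\triangleleft a\triangleright(y\triangleleft b\triangleright(z\triangleleft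 a\triangleright v))=x\triangleleft a\triangleright(y\triangleleft b\triangleright v)$. $E\vdash t=t'$ means derivability in equational logic from the set $E$ of equations. A stateful proposition algebra (SPA) is a two-sorted algebra with sorts $C$ and $S$ (states), with the operations of $\Sigma^A_{ce}$ on sort $C$, a constant $c$ of sort $S$, and operations $\cdot\triangleleft\cdot\triangleright\cdot:S\times C\times S\to S$, $\bullet:C\times S\to S$ (apply), $!:C\times S\to C$ (reply), satisfying CP on sort $C$ and, for all $x,y,z$ in $C$ and $s,s'$ in $S$ ($\bullet$ and $!$ bind stronger than the conditional): (TS1) $s\triangleleft T\triangleright s'=s$; (TS2) $s\triangleleft F\triangleright s'=s'$; (TS3) if $x\neq T$ and $x\neq F$ then $s\triangleleft x\triangleright s'=c$; (SPA1) $T!s=T$; (SPA2) $F!s=F$; (SPA3) $(x\triangleleft y\triangleright z)!s=x!(y\bullet s)\triangleleft y!s\triangleright z!(y\bullet s)$; (SPA4) $T\bullet s=s$; (SPA5) $F\bullet s=s$; (SPA6) $(x\triangleleft y\triangleright z)\bullet s=x\bullet(y\bullet s)\triangleleft y!s\triangleright z\bullet(y\bullet s)$; (SPA7) $x!s=T$ or $x!s=F$; (SPA8) if $x!s=y!s$ and $x\bullet s=y\bullet s$ for all $s$ in $S$, then $x=y$. A Hoare-McCarthy algebra (HMA) is the $\Sigma^A_{ce}$-reduct of a stateful proposition algebra (i.e. sort $C$ with the operations of $\Sigma^A_{ce}$). -}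

module Defs where

open import Data.Empty using (⊥; ⊥-elim)
open import Data.Fin using (Fin)
open import Data.Nat using (ℕ)
open import Data.Product using (_×_; ∃; ∃₂)
open import Data.Sum using (_⊎_)
open import Function.Bundles using (_↔_)
open import Level using (0ℓ)
open import Relation.Binary.Bundles using (Setoid)
open import Relation.Binary.PropositionalEquality using (_≡_; _≢_)
open import Relation.Nullary using (¬_)

Denumerable : Set → Set
Denumerable A = (∃ λ n → A ↔ Fin n) ⊎ (A ↔ ℕ)

MoreThanOne : Set → Set
MoreThanOne A = ∃₂ λ (a b : A) → a ≢ b

-- x ◁ y ▷ z reads "if y then x else z": the condition is the middle argument.
data Term (A X : Set) : Set where
  var   : X → Term A X
  T F   : Term A X
  atom  : A → Term A X
  _◁_▷_ : (x y z : Term A X) → Term A X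

infix 6 _◁_▷_

OpenTerm : Set → Set
OpenTerm A = Term A ℕ

ClosedTerm : Set → Set
ClosedTerm A = Term A ⊥

_[_] : ∀ {A X Y} → Term A X → (X → Term A Y) → Term A Y
var i       [ σ ] = σ i
T           [ σ ] = T
F           [ σ ] = F
atom a      [ σ ] = atom a
(x ◁ y ▷ z) [ σ ] = (x [ σ ]) ◁ (y [ σ ]) ▷ (z [ σ ])

⌜_⌝ : ∀ {A} → ClosedTerm A → OpenTerm A
⌜ t ⌝ = t [ ⊥-elim ]

Equations : Set → Set₁
Equations A = OpenTerm A → OpenTerm A → Set

module _ {A : Set} where

  private
    x y z u v : OpenTerm A
    x = var 0
    y = var 1
    z = var 2
    u = var 3
    v = var 4

  data CP : Equations A where
    cp1 : CP (x ◁ T ▷ y) x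
    cp2 : CP (x ◁ F ▷ y) y
    cp3 : CP (T ◁ x ▷ F) x
    cp4 : CP (x ◁ (y ◁ z ▷ u) ▷ v) ((x ◁ y ▷ v) ◁ z ▷ (x ◁ u ▷ v))

  data CPwm : Equations A where
    cp  : ∀ {t t′} → CP t t′ → CPwm t t′
    cr1 : ∀ a → CPwm ((x ◁ atom a ▷ y) ◁ atom a ▷ z) (x ◁ atom a ▷ z)
    cr2 : ∀ a → CPwm (x ◁ atom a ▷ (y ◁ atom a ▷ z)) (x ◁ atom a ▷ z)
    wm1 : ∀ a b → CPwm (((x ◁ atom a ▷ y) ◁ atom b ▷ z) ◁ atom a ▷ v)
                       ((x ◁ atom b ▷ z) ◁ atom a ▷ v)
    wm2 : ∀ a b → CPwm (x ◁ atom a ▷ (y ◁ atom b ▷ (z ◁ atom a ▷ v)))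
                       (x ◁ atom a ▷ (y ◁ atom b ▷ v))

infix 4 _⊢_≐_

data _⊢_≐_ {A : Set} (E : Equations A) : OpenTerm A → OpenTerm A → Set where
  axiom      : ∀ {t t′} → E t t′ → E ⊢ t ≐ t′
  reflexive  : ∀ {t} → E ⊢ t ≐ t
  symmetric  : ∀ {t t′} → E ⊢ t ≐ t′ → E ⊢ t′ ≐ t
  transitive : ∀ {t t′ t″} → E ⊢ t ≐ t′ → E ⊢ t′ ≐ t″ → E ⊢ t ≐ t″
  congruent  : ∀ {x x′ y y′ z z′} → E ⊢ x ≐ x′ → E ⊢ y ≐ y′ → E ⊢ z ≐ z′ →
               E ⊢ (x ◁ y ▷ z) ≐ (x′ ◁ y′ ▷ z′)
  substitute : ∀ {t t′} (σ : ℕ → OpenTerm A) → E ⊢ t ≐ t′ → E ⊢ (t [ σ ]) ≐ (t′ [ σ ])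

-- Quotient carriers are not available, so each sort is a setoid whose
-- equivalence plays the role of equality, and operations must respect it.
record CeAlgebra (A : Set) : Set₁ where
  field
    setoid : Setoid 0ℓ 0ℓ
  open Setoid setoid public
  field
    true false : Carrier
    atomᶜ      : A → Carrier
    cond       : Carrier → Carrier → Carrier → Carrier
    cond-cong  : ∀ {x x′ y y′ z z′} → x ≈ x′ → y ≈ y′ → z ≈ z′ →
                 cond x y z ≈ cond x′ y′ z′

module _ {A : Set} (𝔸 : CeAlgebra A) where
  open CeAlgebra 𝔸

  ⟦_⟧ : OpenTerm A → (ℕ → Carrier) → Carrier
  ⟦ var i ⟧     ρ = ρ i
  ⟦ T ⟧         ρ = true
  ⟦ F ⟧         ρ = false
  ⟦ atom a ⟧    ρ = atomᶜ a
  ⟦ x ◁ y ▷ z ⟧ ρ = cond (⟦ x ⟧ ρ) (⟦ y ⟧ ρ) (⟦ z ⟧ ρ)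

  infix 4 _⊨_≐_

  _⊨_≐_ : OpenTerm A → OpenTerm A → Set
  _⊨_≐_ t t′ = ∀ ρ → ⟦ t ⟧ ρ ≈ ⟦ t′ ⟧ ρ

  _⊨ᴱ_ : Equations A → Set
  _⊨ᴱ_ E = ∀ {t t′} → E t t′ → _⊨_≐_ t t′

record StatefulPropositionAlgebra (A : Set) : Set₁ where
  field
    reduct      : CeAlgebra A
    stateSetoid : Setoid 0ℓ 0ℓ

  open CeAlgebra reduct public
    using (_≈_; true; false; cond) renaming (Carrier to C)
  open Setoid stateSetoid public
    using () renaming (Carrier to S; _≈_ to _≈ˢ_)

  infixr 9 _•_
  infix  9 _!_

  field
    c     : S
    condˢ : S → C → S → S
    _•_   : C → S → S
    _!_   : C → S → C

    condˢ-cong : ∀ {s s′ x x′ r r′} → s ≈ˢ s′ → x ≈ x′ → r ≈ˢ r′ →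
                 condˢ s x r ≈ˢ condˢ s′ x′ r′
    •-cong     : ∀ {x x′ s s′} → x ≈ x′ → s ≈ˢ s′ → x • s ≈ˢ x′ • s′
    !-cong     : ∀ {x x′ s s′} → x ≈ x′ → s ≈ˢ s′ → x ! s ≈ x′ ! s′

    satisfiesCP : reduct ⊨ᴱ CP

    ts1 : ∀ s s′ → condˢ s true s′ ≈ˢ s
    ts2 : ∀ s s′ → condˢ s false s′ ≈ˢ s′
    ts3 : ∀ x s s′ → ¬ (x ≈ true) → ¬ (x ≈ false) → condˢ s x s′ ≈ˢ c

    spa1 : ∀ s → true ! s ≈ true
    spa2 : ∀ s → false ! s ≈ false
    spa3 : ∀ x y z s → cond x y z ! s ≈ cond (x ! (y • s)) (y ! s) (z ! (y • s))
    spa4 : ∀ s → true • s ≈ˢ s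
    spa5 : ∀ s → false • s ≈ˢ s
    spa6 : ∀ x y z s → cond x y z • s ≈ˢ condˢ (x • (y • s)) (y ! s) (z • (y • s))
    spa7 : ∀ x s → (x ! s ≈ true) ⊎ (x ! s ≈ false)
    spa8 : ∀ x y → (∀ s → (x ! s ≈ y ! s) × (x • s ≈ˢ y • s)) → x ≈ y

IsHoareMcCarthyAlgebra : ∀ {A} → CeAlgebra A → Set₁
IsHoareMcCarthyAlgebra {A} 𝔸 =
  ∃ λ (𝕊 : StatefulPropositionAlgebra A) → StatefulPropositionAlgebra.reduct 𝕊 ≡ 𝔸

{-# OPTIONS --safe #-}

-- A state consists of the history of the atoms asked so far with their replies,
-- and a finite oracle for future replies. An atom occurring in the latest block
-- of equal replies of the history gets that reply again, and nothing is recorded;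
-- otherwise the oracle replies (false once exhausted) and the history grows. All
-- CPwm axioms hold for this evaluation. Conversely every closed term is provably
-- equal to a decision tree that never asks an atom whose reply is known, and since
-- the history records exactly the path followed, a tree is determined by its runs.
module Submission where

open import Data.Bool using (Bool; true; false)
import Data.Bool.Properties as Bool
import Data.Fin.Properties as Fin
open import Data.List using (List; []; _∷_; _++_; _∷ʳ_)
open import Data.List.Properties using (++-assoc; ++-cancelʳ; ++-identityˡ-unique; ∷ʳ-injectiveʳ)
open import Data.Nat using (ℕ)
import Data.Nat.Properties as ℕ
open import Data.Product using (_×_; _,_; ∃; proj₁; proj₂)
open import Data.Sum using (_⊎_; inj₁; inj₂)
open import Function.Bundles using (_⇔_; mk⇔)
open import Function.Properties.Inverse using (↔⇒↣)
open import Relation.Binary.Definitions using (DecidableEquality)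
open import Relation.Binary.PropositionalEquality
  using (_≡_; _≢_; refl; sym; trans; cong; cong₂; subst; subst₂; setoid; module ≡-Reasoning)
open import Relation.Nullary using (¬_; Dec; yes; no; contradiction)
open import Relation.Nullary.Decidable using (via-injection)
open import Defs

denumerable⇒≟ : ∀ {A} → Denumerable A → DecidableEquality A
denumerable⇒≟ (inj₁ (_ , A↔Fin)) = via-injection (↔⇒↣ A↔Fin) Fin._≟_
denumerable⇒≟ (inj₂ A↔ℕ)         = via-injection (↔⇒↣ A↔ℕ) ℕ._≟_

-- Soundness of equational logic for any algebra satisfying the axioms.

module _ {A : Set} (𝔸 : CeAlgebra A) where
  open CeAlgebra 𝔸 using (_≈_; cond; cond-cong)
    renaming (refl to ≈-refl; sym to ≈-sym; trans to ≈-trans)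

  ⟦⟧-[] : ∀ t (σ : ℕ → OpenTerm A) ρ → ⟦ 𝔸 ⟧ (t [ σ ]) ρ ≡ ⟦ 𝔸 ⟧ t (λ i → ⟦ 𝔸 ⟧ (σ i) ρ)
  ⟦⟧-[] (var i)     σ ρ = refl
  ⟦⟧-[] T           σ ρ = refl
  ⟦⟧-[] F           σ ρ = refl
  ⟦⟧-[] (atom a)    σ ρ = refl
  ⟦⟧-[] (x ◁ y ▷ z) σ ρ
    rewrite ⟦⟧-[] x σ ρ | ⟦⟧-[] y σ ρ | ⟦⟧-[] z σ ρ = refl

  soundness : ∀ {E : Equations A} → 𝔸 ⊨ᴱ E → ∀ {t t′} → E ⊢ t ≐ t′ → 𝔸 ⊨ t ≐ t′
  soundness ⊨E (axiom e)        ρ = ⊨E e ρ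
  soundness ⊨E reflexive        ρ = ≈-refl
  soundness ⊨E (symmetric d)    ρ = ≈-sym (soundness ⊨E d ρ)
  soundness ⊨E (transitive d e) ρ = ≈-trans (soundness ⊨E d ρ) (soundness ⊨E e ρ)
  soundness ⊨E (congruent d e f) ρ =
    cond-cong (soundness ⊨E d ρ) (soundness ⊨E e ρ) (soundness ⊨E f ρ)
  soundness ⊨E (substitute {t} {t′} σ d) ρ =
    subst₂ _≈_ (sym (⟦⟧-[] t σ ρ)) (sym (⟦⟧-[] t′ σ ρ))
      (soundness ⊨E d (λ i → ⟦ 𝔸 ⟧ (σ i) ρ))

-- Histories, oracle states and decision trees.

History : Set → Set
History A = List (A × Bool)

State : Set → Set
State A = History A × List Bool

-- Known a σ h: a occurs in the latest block of equal replies of h, and these are σ.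
data Known {A : Set} (a : A) (σ : Bool) : History A → Set where
  here  : ∀ {h} → Known a σ ((a , σ) ∷ h)
  there : ∀ {b h} → Known a σ h → Known a σ ((b , σ) ∷ h)

data Tree (A : Set) : Set where
  leaf : Bool → Tree A
  node : A → Tree A → Tree A → Tree A

module _ {A : Set} where

  known-unique : ∀ {a b : A} {σ τ h} → Known a σ h → Known b τ h → σ ≡ τ
  known-unique here      here      = refl
  known-unique here      (there _) = refl
  known-unique (there _) here      = refl
  known-unique (there _) (there _) = refl

  ask : A → State A → Bool × State A
  ask a (h , [])    = false , ((a , false) ∷ h , [])
  ask a (h , b ∷ o) = b , ((a , b) ∷ h , o)

  branch : ∀ {R : Set} → (State A → R) → (State A → R) → Bool × State A → R
  branch f g (true  , s) = f s
  branch f g (false , s) = g s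

  branch-cong : ∀ {R : Set} {f f′ g g′ : State A → R} →
                (∀ s → f s ≡ f′ s) → (∀ s → g s ≡ g′ s) →
                ∀ r → branch f g r ≡ branch f′ g′ r
  branch-cong f≗f′ g≗g′ (true  , s) = f≗f′ s
  branch-cong f≗f′ g≗g′ (false , s) = g≗g′ s

  branch-branch : ∀ {R : Set} (f g : State A → R) (k l : State A → Bool × State A) r →
                  branch f g (branch k l r) ≡
                  branch (λ s → branch f g (k s)) (λ s → branch f g (l s)) r
  branch-branch f g k l (true  , s) = refl
  branch-branch f g k l (false , s) = refl

  -- Recovering a decision tree from its runs.

  run : Tree A → State A → Bool × State A
  run (leaf b)     s = b , s
  run (node a p q) s = branch (run p) (run q) (ask a s)

  run-extends : ∀ p h o → ∃ λ w → proj₁ (proj₂ (run p (h , o))) ≡ w ++ h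
  run-extends (leaf b) h o = [] , refl
  run-extends (node a p q) h [] =
    let w , eq = run-extends q ((a , false) ∷ h) []
    in w ∷ʳ (a , false) , trans eq (sym (++-assoc w _ h))
  run-extends (node a p q) h (true ∷ o) =
    let w , eq = run-extends p ((a , true) ∷ h) o
    in w ∷ʳ (a , true) , trans eq (sym (++-assoc w _ h))
  run-extends (node a p q) h (false ∷ o) =
    let w , eq = run-extends q ((a , false) ∷ h) o
    in w ∷ʳ (a , false) , trans eq (sym (++-assoc w _ h))

  -- The exhausted oracle replies `false`, so the entry directly above `h` in the final history
  -- exposes the root atom.
  run-node-extends : ∀ a p q h →
                     ∃ λ w → proj₁ (proj₂ (run (node a p q) (h , []))) ≡ w ∷ʳ (a , false) ++ h
  run-node-extends a p q h =
    let w , eq = run-extends q ((a , false) ∷ h) []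
    in w , trans eq (sym (++-assoc w _ h))

  ∷ʳ-≢[] : ∀ (w : History A) {e} → w ∷ʳ e ≢ []
  ∷ʳ-≢[] []      ()
  ∷ʳ-≢[] (_ ∷ _) ()

  run-leaf≢node : ∀ b a p q h → run (leaf b) (h , []) ≢ run (node a p q) (h , [])
  run-leaf≢node b a p q h eq =
    let w , eq′ = run-node-extends a p q h
    in ∷ʳ-≢[] w (++-identityˡ-unique _ (trans (cong (λ r → proj₁ (proj₂ r)) eq) eq′))

  -- The empty oracle exposes the root; an oracle starting with `true` or `false` steers both runs
  -- into the corresponding subtrees. Their histories are then longer, hence the general `h`.
  run-injective : ∀ p q h → (∀ o → run p (h , o) ≡ run q (h , o)) → p ≡ q
  run-injective (leaf b) (leaf b′) h eq = cong leaf (cong proj₁ (eq []))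
  run-injective (leaf b) (node a p q) h eq =
    contradiction (eq []) (run-leaf≢node b a p q h)
  run-injective (node a p q) (leaf b) h eq =
    contradiction (sym (eq [])) (run-leaf≢node b a p q h)
  run-injective (node a p q) (node a′ p′ q′) h eq
    with w , e ← run-node-extends a p q h | w′ , e′ ← run-node-extends a′ p′ q′ h
    -- Once the common suffix `h` is cancelled, the last entries are the two root queries, so the
    -- root atoms agree.
    with refl ← ∷ʳ-injectiveʳ w w′ (++-cancelʳ h _ _
           (trans (sym e) (trans (cong (λ r → proj₁ (proj₂ r)) (eq [])) e′)))
    = cong₂ (node a)
        (run-injective p p′ _ (λ o → eq (true ∷ o)))
        (run-injective q q′ _ (λ o → eq (false ∷ o)))

  -- Provable equality at the end of a path.

  constant : ∀ {X} → Bool → Term A X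
  constant true  = T
  constant false = F

  toTerm : Tree A → OpenTerm A
  toTerm (leaf b)     = constant b
  toTerm (node a p q) = toTerm p ◁ atom a ▷ toTerm q

  -- graft true a p r = p ◁ a ▷ r and graft false a p r = r ◁ a ▷ p: this makes
  -- CPcr1, CPcr2 (and CPwm1, CPwm2) two instances of one scheme.
  graft : Bool → A → OpenTerm A → OpenTerm A → OpenTerm A
  graft true  a p r = p ◁ atom a ▷ r
  graft false a p r = r ◁ atom a ▷ p

  -- Instantiates the five variables of the axioms; below, `T` fills the slot of a variable absent
  -- from the axiom at hand.
  ⟨_,_,_,_,_⟩ : (x y z u v : OpenTerm A) → ℕ → OpenTerm A
  ⟨ x , y , z , u , v ⟩ 0 = x
  ⟨ x , y , z , u , v ⟩ 1 = y
  ⟨ x , y , z , u , v ⟩ 2 = z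
  ⟨ x , y , z , u , v ⟩ 3 = u
  ⟨ x , y , z , u , v ⟩ _ = v

  graft-cong : ∀ σ a {p p′} r → CPwm ⊢ p ≐ p′ → CPwm ⊢ graft σ a p r ≐ graft σ a p′ r
  graft-cong true  a r d = congruent d reflexive reflexive
  graft-cong false a r d = congruent reflexive reflexive d

  graft-cr : ∀ σ a x y z → CPwm ⊢ graft σ a (graft σ a x y) z ≐ graft σ a x z
  graft-cr true  a x y z = substitute ⟨ x , y , z , T , T ⟩ (axiom (cr1 a))
  graft-cr false a x y z = substitute ⟨ z , y , x , T , T ⟩ (axiom (cr2 a))

  graft-wm : ∀ σ a b x y z v →
             CPwm ⊢ graft σ a (graft σ b (graft σ a x y) z) v ≐ graft σ a (graft σ b x z) v
  graft-wm true  a b x y z v = substitute ⟨ x , y , z , T , v ⟩ (axiom (wm1 a b))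
  graft-wm false a b x y z v = substitute ⟨ v , z , y , T , x ⟩ (axiom (wm2 a b))

  infix 4 _⊩_≐_

  -- Provable equality of the terms obtained by placing p and q at the end of the
  -- path h, whatever stands beside that path.
  _⊩_≐_ : History A → OpenTerm A → OpenTerm A → Set
  []            ⊩ p ≐ q = CPwm ⊢ p ≐ q
  ((a , σ) ∷ h) ⊩ p ≐ q = ∀ r → h ⊩ graft σ a p r ≐ graft σ a q r

  ⊩-fromEq : ∀ h {p q} → CPwm ⊢ p ≐ q → h ⊩ p ≐ q
  ⊩-fromEq []            d   = d
  ⊩-fromEq ((a , σ) ∷ h) d r = ⊩-fromEq h (graft-cong σ a r d)

  ⊩-sym : ∀ h {p q} → h ⊩ p ≐ q → h ⊩ q ≐ p
  ⊩-sym []      d   = symmetric d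
  ⊩-sym (_ ∷ h) d r = ⊩-sym h (d r)

  ⊩-trans : ∀ h {p q r} → h ⊩ p ≐ q → h ⊩ q ≐ r → h ⊩ p ≐ r
  ⊩-trans []      d e   = transitive d e
  ⊩-trans (_ ∷ h) d e r = ⊩-trans h (d r) (e r)

  -- The weak-memory axioms skip one intermediate atom b only. Longer blocks are
  -- handled by testing a once more above b, which the induction hypothesis allows.
  ⊩-known : ∀ {a σ h} → Known a σ h → ∀ p q → h ⊩ graft σ a p q ≐ p
  ⊩-known {a} {σ} {_ ∷ h} here p q r = ⊩-fromEq h (graft-cr σ a p q r)
  ⊩-known {a} {σ} {(b , _) ∷ h} (there k) p q r =
    ⊩-trans h (⊩-sym h (⊩-known k _ T))
      (⊩-trans h (⊩-fromEq h (graft-wm σ a b p q r T)) (⊩-known k _ T))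

  -- Each hypothesis allows any term in the opposite branch, so the branches are replaced one after
  -- the other: first beside the old `q`, then beside the new `p′`.
  ⊩-node : ∀ h a {p p′ q q′} → ((a , true) ∷ h) ⊩ p ≐ p′ → ((a , false) ∷ h) ⊩ q ≐ q′ →
           h ⊩ p ◁ atom a ▷ q ≐ p′ ◁ atom a ▷ q′
  ⊩-node h a {p′ = p′} {q = q} d e = ⊩-trans h (d q) (e p′)

-- Evaluation with weak memory.

module WeaklyMemorizing {A : Set} (_≟_ : DecidableEquality A) where

  known? : ∀ (a : A) h → Dec (∃ λ σ → Known a σ h)
  known? a [] = no λ ()
  known? a ((b , τ) ∷ h) with a ≟ b
  ... | yes refl = yes (τ , here)
  ... | no a≢b with known? a h
  ...   | no ¬k = no λ { (_ , here) → a≢b refl ; (σ , there k) → ¬k (σ , k) }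
  -- The latest reply `τ` prolongs the block of `a` only if it equals `σ`; otherwise a new block has
  -- begun and `a` is forgotten.
  ...   | yes (σ , k) with σ Bool.≟ τ
  ...     | yes refl = yes (σ , there k)
  ...     | no σ≢τ = no λ { (_ , here) → a≢b refl ; (_ , there k′) → σ≢τ (known-unique k k′) }

  reply : A → State A → Bool × State A
  reply a s with known? a (proj₁ s)
  ... | yes (σ , _) = σ , s
  ... | no _        = ask a s

  reply-known : ∀ {a σ} s → Known a σ (proj₁ s) → reply a s ≡ (σ , s)
  reply-known {a} s k with known? a (proj₁ s)
  ... | yes (_ , k′) = cong (_, s) (known-unique k′ k)
  ... | no ¬k        = contradiction (_ , k) ¬k

  reply-learns : ∀ a s {σ s′} → reply a s ≡ (σ , s′) → Known a σ (proj₁ s′)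
  reply-learns a s eq with known? a (proj₁ s)
  reply-learns a s           refl | yes (_ , k) = k
  reply-learns a (h , [])    refl | no _        = here
  reply-learns a (h , _ ∷ o) refl | no _        = here

  -- An equal reply either leaves the history alone or prolongs its current block.
  reply-remembers : ∀ b s {a σ s′} → Known a σ (proj₁ s) → reply b s ≡ (σ , s′) →
                    Known a σ (proj₁ s′)
  reply-remembers b s k eq with known? b (proj₁ s)
  reply-remembers b s           k refl | yes _ = k
  reply-remembers b (h , [])    k refl | no _  = there k
  reply-remembers b (h , _ ∷ o) k refl | no _  = there k

  eval : ClosedTerm A → State A → Bool × State A
  eval T           s = true , s
  eval F           s = false , s
  eval (atom a)    s = reply a s
  eval (x ◁ y ▷ z) s = branch (eval x) (eval z) (eval y s)

  infix 4 _≋_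

  _≋_ : ClosedTerm A → ClosedTerm A → Set
  x ≋ y = ∀ s → eval x s ≡ eval y s

  ◁▷-cong : ∀ {x x′ y y′ z z′} → x ≋ x′ → y ≋ y′ → z ≋ z′ → x ◁ y ▷ z ≋ x′ ◁ y′ ▷ z′
  ◁▷-cong {y′ = y′} x≋ y≋ z≋ s rewrite y≋ s = branch-cong x≋ z≋ (eval y′ s)

  -- The algebra of closed terms under equality of evaluation.

  𝔸wm : CeAlgebra A
  𝔸wm = record
    { setoid = record
        { Carrier       = ClosedTerm A
        ; _≈_           = _≋_
        ; isEquivalence = record
            { refl  = λ _ → refl
            ; sym   = λ x≋y s → sym (x≋y s)
            ; trans = λ x≋y y≋z s → trans (x≋y s) (y≋z s)
            }
        }
    ; true      = T
    ; false     = F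
    ; atomᶜ     = atom
    ; cond      = _◁_▷_
    ; cond-cong = λ {x} {x′} {y} {y′} {z} {z′} → ◁▷-cong {x} {x′} {y} {y′} {z} {z′}
    }

  ⟦⌜⌝⟧ : ∀ t ρ → ⟦ 𝔸wm ⟧ ⌜ t ⌝ ρ ≡ t
  ⟦⌜⌝⟧ T           ρ = refl
  ⟦⌜⌝⟧ F           ρ = refl
  ⟦⌜⌝⟧ (atom a)    ρ = refl
  ⟦⌜⌝⟧ (x ◁ y ▷ z) ρ
    rewrite ⟦⌜⌝⟧ x ρ | ⟦⌜⌝⟧ y ρ | ⟦⌜⌝⟧ z ρ = refl

  -- The two sides of a memory axiom differ only where `a` is asked again after equal replies, and
  -- there its reply is already known.
  𝔸wm⊨CPwm : 𝔸wm ⊨ᴱ CPwm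
  𝔸wm⊨CPwm (cp cp1) ρ s = refl
  𝔸wm⊨CPwm (cp cp2) ρ s = refl
  𝔸wm⊨CPwm (cp cp3) ρ s with eval (ρ 0) s
  ... | true  , _ = refl
  ... | false , _ = refl
  𝔸wm⊨CPwm (cp cp4) ρ s = branch-branch _ _ _ _ (eval (ρ 2) s)
  𝔸wm⊨CPwm (cr1 a) ρ s with reply a s in eq
  ... | true  , s₁ rewrite reply-known s₁ (reply-learns a s eq) = refl
  ... | false , _  = refl
  𝔸wm⊨CPwm (cr2 a) ρ s with reply a s in eq
  ... | true  , _  = refl
  ... | false , s₁ rewrite reply-known s₁ (reply-learns a s eq) = refl
  𝔸wm⊨CPwm (wm1 a b) ρ s with reply a s in eq
  ... | false , _  = refl
  ... | true  , s₁ with reply b s₁ in eq₁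
  ...   | true  , s₂
    rewrite reply-known s₂ (reply-remembers b s₁ (reply-learns a s eq) eq₁) = refl
  ...   | false , _ = refl
  𝔸wm⊨CPwm (wm2 a b) ρ s with reply a s in eq
  ... | true  , _  = refl
  ... | false , s₁ with reply b s₁ in eq₁
  ...   | true  , _  = refl
  ...   | false , s₂
    rewrite reply-known s₂ (reply-remembers b s₁ (reply-learns a s eq) eq₁) = refl

  ⊨⇒≋ : ∀ t t′ → 𝔸wm ⊨ ⌜ t ⌝ ≐ ⌜ t′ ⌝ → t ≋ t′
  -- Closed terms ignore the valuation, so any one serves.
  ⊨⇒≋ t t′ valid = subst₂ _≋_ (⟦⌜⌝⟧ t (λ _ → T)) (⟦⌜⌝⟧ t′ (λ _ → T)) (valid (λ _ → T))

  -- Normal forms and completeness.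

  -- The tree of k ◁ t ▷ l after the history h.
  norm : ClosedTerm A → History A → (k l : History A → Tree A) → Tree A
  norm T           h k l = k h
  norm F           h k l = l h
  norm (atom a)    h k l with known? a h
  ... | yes (true  , _) = k h
  ... | yes (false , _) = l h
  ... | no _            = node a (k ((a , true) ∷ h)) (l ((a , false) ∷ h))
  norm (x ◁ y ▷ z) h k l = norm y h (λ h′ → norm x h′ k l) (λ h′ → norm z h′ k l)

  nf : ClosedTerm A → Tree A
  nf t = norm t [] (λ _ → leaf true) (λ _ → leaf false)

  -- The hypotheses range over all histories because the replies met inside `t` decide with which
  -- one `x` or `y` is reached.
  norm-provable : ∀ t h {x y k l} →
                  (∀ h′ → h′ ⊩ x ≐ toTerm (k h′)) → (∀ h′ → h′ ⊩ y ≐ toTerm (l h′)) →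
                  h ⊩ x ◁ ⌜ t ⌝ ▷ y ≐ toTerm (norm t h k l)
  norm-provable T h {x} {y} dk dl =
    ⊩-trans h (⊩-fromEq h (substitute ⟨ x , y , T , T , T ⟩ (axiom (cp cp1)))) (dk h)
  norm-provable F h {x} {y} dk dl =
    ⊩-trans h (⊩-fromEq h (substitute ⟨ x , y , T , T , T ⟩ (axiom (cp cp2)))) (dl h)
  norm-provable (atom a) h {x} {y} dk dl with known? a h
  ... | yes (true  , known) = ⊩-trans h (⊩-known known x y) (dk h)
  ... | yes (false , known) = ⊩-trans h (⊩-known known y x) (dl h)
  ... | no _ = ⊩-node h a (dk ((a , true) ∷ h)) (dl ((a , false) ∷ h))
  norm-provable (t ◁ u ▷ v) h {x} {y} dk dl =
    ⊩-trans h
      (⊩-fromEq h (substitute ⟨ x , ⌜ t ⌝ , ⌜ u ⌝ , ⌜ v ⌝ , y ⟩ (axiom (cp cp4))))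
      (norm-provable u h (λ h′ → norm-provable t h′ dk dl)
                         (λ h′ → norm-provable v h′ dk dl))

  nf-provable : ∀ t → CPwm ⊢ ⌜ t ⌝ ≐ toTerm (nf t)
  nf-provable t = transitive
    (symmetric (substitute ⟨ ⌜ t ⌝ , T , T , T , T ⟩ (axiom (cp cp3))))
    (norm-provable t [] (λ h → ⊩-fromEq h reflexive) (λ h → ⊩-fromEq h reflexive))

  runAt : (History A → Tree A) → State A → Bool × State A
  runAt k s = run (k (proj₁ s)) s

  -- `run` asks every atom it meets and `eval` records only unknown ones; they agree because `norm`
  -- drops the atoms known in the very history from which the tree is run.
  run-norm : ∀ t k l s → runAt (λ h → norm t h k l) s ≡ branch (runAt k) (runAt l) (eval t s)
  run-norm T k l s = refl
  run-norm F k l s = refl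
  run-norm (atom a) k l s with known? a (proj₁ s)
  run-norm (atom a) k l s | yes (true  , _) = refl
  run-norm (atom a) k l s | yes (false , _) = refl
  run-norm (atom a) k l (h , [])        | no _ = refl
  run-norm (atom a) k l (h , true  ∷ o) | no _ = refl
  run-norm (atom a) k l (h , false ∷ o) | no _ = refl
  run-norm (x ◁ y ▷ z) k l s = begin
    runAt (λ h → norm (x ◁ y ▷ z) h k l) s
      ≡⟨ run-norm y _ _ s ⟩
    branch (runAt (λ h → norm x h k l)) (runAt (λ h → norm z h k l)) (eval y s)
      ≡⟨ branch-cong (run-norm x k l) (run-norm z k l) (eval y s) ⟩
    branch (λ s′ → branch (runAt k) (runAt l) (eval x s′))
           (λ s′ → branch (runAt k) (runAt l) (eval z s′)) (eval y s)
      ≡⟨ branch-branch _ _ _ _ (eval y s) ⟨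
    branch (runAt k) (runAt l) (eval (x ◁ y ▷ z) s) ∎
    where open ≡-Reasoning

  run-nf : ∀ t o → run (nf t) ([] , o) ≡ eval t ([] , o)
  -- The two leaves turn the result into the evaluation of `T ◁ t ▷ F`, to which CP3 applies.
  run-nf t o = trans (run-norm t _ _ ([] , o)) (𝔸wm⊨CPwm (cp cp3) (λ _ → t) ([] , o))

  ≋⇒nf≡ : ∀ x y → x ≋ y → nf x ≡ nf y
  ≋⇒nf≡ x y x≋y = run-injective (nf x) (nf y) []
    (λ o → trans (run-nf x o) (trans (x≋y _) (sym (run-nf y o))))

  nf≡⇒⊢ : ∀ x y → nf x ≡ nf y → CPwm ⊢ ⌜ x ⌝ ≐ ⌜ y ⌝
  nf≡⇒⊢ x y eq = transitive (nf-provable x)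
    (subst (λ p → CPwm ⊢ toTerm p ≐ ⌜ y ⌝) (sym eq) (symmetric (nf-provable y)))

  -- `run-nf` covers the empty history only; all other states are reached through a derivation and
  -- soundness.
  nf≡⇒≋ : ∀ x y → nf x ≡ nf y → x ≋ y
  nf≡⇒≋ x y eq = ⊨⇒≋ x y (soundness 𝔸wm 𝔸wm⊨CPwm (nf≡⇒⊢ x y eq))

  -- The stateful proposition algebra over these states.

  choose : State A → Tree A → State A → State A
  choose s (leaf true)  s′ = s
  choose s (leaf false) s′ = s′
  choose s (node _ _ _) s′ = [] , []

  -- TS1 to TS3 depend on whether a condition equals `T` or `F`; normal forms decide this, a `node`
  -- yielding the constant state `c`.
  choose-nf-otherwise : ∀ x s s′ → ¬ x ≋ T → ¬ x ≋ F → choose s (nf x) s′ ≡ ([] , [])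
  choose-nf-otherwise x s s′ x≉T x≉F with nf x in eq
  ... | leaf true  = contradiction (nf≡⇒≋ x T eq) x≉T
  ... | leaf false = contradiction (nf≡⇒≋ x F eq) x≉F
  ... | node _ _ _ = refl

  replyTerm : ClosedTerm A → State A → ClosedTerm A
  replyTerm x s = constant (proj₁ (eval x s))

  constant-injective : ∀ b b′ → constant b ≋ constant b′ → b ≡ b′
  constant-injective true  true  eq = refl
  constant-injective true  false eq = cong proj₁ (eq ([] , []))
  constant-injective false true  eq = cong proj₁ (eq ([] , []))
  constant-injective false false eq = refl

  𝕊wm : StatefulPropositionAlgebra A
  𝕊wm = record
    { reduct      = 𝔸wm
    ; stateSetoid = setoid (State A)
    ; c           = [] , []
    ; condˢ       = λ s x s′ → choose s (nf x) s′
    ; _•_         = λ x s → proj₂ (eval x s)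
    ; _!_         = replyTerm
    -- `choose` inspects a normal form, so it respects `≋` because equal evaluation forces equal
    -- normal forms.
    ; condˢ-cong  = λ { {s} {x = x} {x′} {r} refl x≋x′ refl →
                        cong (λ p → choose s p r) (≋⇒nf≡ x x′ x≋x′) }
    ; •-cong      = λ { {s = s} x≋x′ refl → cong proj₂ (x≋x′ s) }
    ; !-cong      = λ { {s = s} x≋x′ refl s′ →
                        cong (λ r → eval (constant (proj₁ r)) s′) (x≋x′ s) }
    ; satisfiesCP = λ e → 𝔸wm⊨CPwm (cp e)
    ; ts1         = λ _ _ → refl
    ; ts2         = λ _ _ → refl
    ; ts3         = choose-nf-otherwise
    ; spa1        = λ _ _ → refl
    ; spa2        = λ _ _ → refl
    ; spa3        = spa3
    ; spa4        = λ _ → refl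
    ; spa5        = λ _ → refl
    ; spa6        = spa6
    ; spa7        = spa7
    -- Reply and final state are the two components of `eval`.
    ; spa8        = λ x y same s → cong₂ _,_
        (constant-injective (proj₁ (eval x s)) (proj₁ (eval y s)) (proj₁ (same s)))
        (proj₂ (same s))
    }
    where
    spa3 : ∀ x y z s → replyTerm (x ◁ y ▷ z) s ≋
             replyTerm x (proj₂ (eval y s)) ◁ replyTerm y s ▷ replyTerm z (proj₂ (eval y s))
    spa3 x y z s _ with eval y s
    ... | true  , _ = refl
    ... | false , _ = refl

    spa6 : ∀ x y z s → proj₂ (eval (x ◁ y ▷ z) s) ≡
             choose (proj₂ (eval x (proj₂ (eval y s)))) (nf (replyTerm y s))
                    (proj₂ (eval z (proj₂ (eval y s))))
    spa6 x y z s with eval y s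
    ... | true  , _ = refl
    ... | false , _ = refl

    spa7 : ∀ x s → (replyTerm x s ≋ T) ⊎ (replyTerm x s ≋ F)
    spa7 x s with proj₁ (eval x s)
    ... | true  = inj₁ λ _ → refl
    ... | false = inj₂ λ _ → refl

  ⊢⇔⊨ : ∀ t t′ → (CPwm ⊢ ⌜ t ⌝ ≐ ⌜ t′ ⌝) ⇔ (𝔸wm ⊨ ⌜ t ⌝ ≐ ⌜ t′ ⌝)
  ⊢⇔⊨ t t′ = mk⇔ (soundness 𝔸wm 𝔸wm⊨CPwm)
    (λ valid → nf≡⇒⊢ t t′ (≋⇒nf≡ t t′ (⊨⇒≋ t t′ valid)))

theorem6 : (A : Set) → A → Denumerable A → MoreThanOne A →
    ∃ λ (𝔸 : CeAlgebra A) → IsHoareMcCarthyAlgebra 𝔸 ×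
    ((t t′ : ClosedTerm A) → (CPwm ⊢ ⌜ t ⌝ ≐ ⌜ t′ ⌝) ⇔ (𝔸 ⊨ ⌜ t ⌝ ≐ ⌜ t′ ⌝))
theorem6 A _ denumerable _ = 𝔸wm , (𝕊wm , refl) , ⊢⇔⊨
  where open WeaklyMemorizing (denumerable⇒≟ denumerable)
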